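{- There exists an infinite family of transitive Boolean functions $F_i:\{0,1\}^{N_i}\to\{0,1\}$ ($i\in\mathbb{N}$), with $N_i\to\infty$ and $D(F_i)\to\infty$, such that $$D(F_i)=\widetilde{\Omega}\big(s(F_i)^3\big).$$
   Context: A subgroup $G\le S_N$ is transitive if for all $i,j\in[N]$ there is $\sigma\in G$ with $\sigma(i)=j$. A function $f:\{0,1\}^N\to\{0,1\}$ is transitive if there is a transitive group $G\le S_N$ such that $f(x_1,\dots,x_N)=f(x_{\sigma(1)},\dots,x_{\sigma(N)})$ for all $x\in\{0,1\}^N$ and all $\sigma\in G$. For total $f:\{0,1\}^N\to\{0,1\}$: - $D(f)$, deterministic query complexity, is the worst-case number of queried input bits of the best deterministic query algorithm (decision tree) computing $f$. - $s(f)=\max_{x}|\{i\in[N]: f(x)\ne f(x^{i})\}|$, the sensitivity, where $x^{i}$ is $x$ with bit $i$ flipped. Notation: for quantities $A_i,B_i$ attached to $F_i$, $A_i=\widetilde{\Omega}(B_i)$ means that there are constants $c>0$ and $C\ge 0$ with $A_i\ge c\,B_i/(\log N_i)^C$ for all sufficiently large $i$. -}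

module Defs where

open import Data.Bool using (Bool; true; false; not; if_then_else_)
open import Data.Bool.Properties as Bool using ()
open import Data.Fin using (Fin; zero; suc)
open import Data.Fin.Permutation as Perm using (Permutation′; _⟨$⟩ʳ_; _∘ₚ_)
open import Data.Fin.Properties using (any?)
open import Data.Fin.Subset.Properties using (anySubset?)
open import Data.Integer as ℤ using ()
open import Data.List as List using (List; []; _∷_; _++_; allFin; filter; length)
open import Data.List.Extrema.Nat using (max)
open import Data.Nat using (ℕ; zero; suc; _^_; _⊔_; _≤_; z≤n; s≤s)
open import Data.Nat.Logarithm using (⌊log₂_⌋)
open import Data.Nat.Properties as ℕ using (⊔-lub; m⊔n≤o⇒m≤o; m⊔n≤o⇒n≤o)
open import Data.Product using (∃; ∃-syntax; Σ-syntax; _×_; _,_; proj₁; proj₂)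
open import Data.Rational as ℚ using (ℚ; 0ℚ)
open import Data.Vec using (Vec; []; _∷_; lookup; tabulate; updateAt)
open import Relation.Binary.PropositionalEquality using (_≡_; refl; trans)
open import Relation.Nullary using (Dec; yes; no; contradiction)
open import Relation.Nullary.Decidable using (¬?; _×-dec_; map′; decidable-stable)
open import Relation.Unary using (Decidable)

BoolFun : ℕ → Set
BoolFun n = Vec Bool n → Bool

------------------------------------------------------------------------
-- Transitive functions

-- Permutations carry proofs and functions, so a set of permutations has to
-- respect pointwise equality.
record IsSubgroup {n} (G : Permutation′ n → Set) : Set where
  field
    resp-≈    : ∀ {σ τ} → σ Perm.≈ τ → G σ → G τ
    id-closed : G Perm.id
    ∘-closed  : ∀ {σ τ} → G σ → G τ → G (σ ∘ₚ τ)
    ⁻¹-closed : ∀ {σ} → G σ → G (Perm.flip σ)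

TransitiveGroup : ∀ {n} → (Permutation′ n → Set) → Set
TransitiveGroup {n} G = ∀ (i j : Fin n) → ∃[ σ ] G σ × σ ⟨$⟩ʳ i ≡ j

permute : ∀ {n} → Permutation′ n → Vec Bool n → Vec Bool n
permute σ x = tabulate λ i → lookup x (σ ⟨$⟩ʳ i)

Transitive : ∀ {n} → BoolFun n → Set₁
Transitive {n} f =
  Σ[ G ∈ (Permutation′ n → Set) ]
    IsSubgroup G × TransitiveGroup G ×
    (∀ σ → G σ → ∀ x → f x ≡ f (permute σ x))

------------------------------------------------------------------------
-- Sensitivity

flipBit : ∀ {n} → Vec Bool n → Fin n → Vec Bool n
flipBit x i = updateAt x i not

sensitivityAt : ∀ {n} → BoolFun n → Vec Bool n → ℕ
sensitivityAt {n} f x =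
  length (filter (λ i → ¬? (f x Bool.≟ f (flipBit x i))) (allFin n))

inputs : ∀ n → List (Vec Bool n)
inputs zero    = [] ∷ []
inputs (suc n) = List.map (false ∷_) (inputs n) ++ List.map (true ∷_) (inputs n)

s : ∀ {n} → BoolFun n → ℕ
s {n} f = max 0 (List.map (sensitivityAt f) (inputs n))

------------------------------------------------------------------------
-- Deterministic query complexity

data DecisionTree (n : ℕ) : Set where
  leaf  : Bool → DecisionTree n
  query : Fin n → DecisionTree n → DecisionTree n → DecisionTree n

eval : ∀ {n} → DecisionTree n → BoolFun n
eval (leaf b)        x = b
eval (query i t₀ t₁) x = if lookup x i then eval t₁ x else eval t₀ x

depth : ∀ {n} → DecisionTree n → ℕ
depth (leaf _)        = 0
depth (query _ t₀ t₁) = suc (depth t₀ ⊔ depth t₁)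

Computes : ∀ {n} → DecisionTree n → BoolFun n → Set
Computes t f = ∀ x → eval t x ≡ f x

HasTreeOfDepth : ∀ {n} → BoolFun n → ℕ → Set
HasTreeOfDepth f d = ∃[ t ] Computes t f × depth t ≡ d

IsLeast : (ℕ → Set) → ℕ → Set
IsLeast P m = P m × (∀ k → P k → m ≤ k)

computes? : ∀ {n} (t : DecisionTree n) (f : BoolFun n) → Dec (Computes t f)
computes? t f = map′
  (λ ¬∃ x → decidable-stable (eval t x Bool.≟ f x) λ ≢ → ¬∃ (x , ≢))
  (λ { eq (x , ≢) → ≢ (eq x) })
  (¬? (anySubset? λ x → ¬? (eval t x Bool.≟ f x)))

anyTree? : ∀ {n} d {Q : DecisionTree n → Set} → Decidable Q →
           Dec (∃[ t ] depth t ≤ d × Q t)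
anyTree? d Q? with Q? (leaf false) | Q? (leaf true)
anyTree? d       Q? | yes q | _     = yes (leaf false , z≤n , q)
anyTree? d       Q? | no _  | yes q = yes (leaf true , z≤n , q)
anyTree? zero    Q? | no ¬f | no ¬t = no λ where
  (leaf false , _ , q) → ¬f q
  (leaf true  , _ , q) → ¬t q
anyTree? (suc d) Q? | no ¬f | no ¬t = map′
  (λ { (i , t₀ , ≤₀ , t₁ , ≤₁ , q) → query i t₀ t₁ , s≤s (⊔-lub ≤₀ ≤₁) , q })
  (λ { (leaf false , _ , q) → contradiction q ¬f
     ; (leaf true  , _ , q) → contradiction q ¬t
     ; (query i t₀ t₁ , s≤s ≤d , q) →
         i , t₀ , m⊔n≤o⇒m≤o _ _ ≤d , t₁ , m⊔n≤o⇒n≤o _ _ ≤d , q })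
  (any? λ i → anyTree? d λ t₀ → anyTree? d λ t₁ → Q? (query i t₀ t₁))

hasTreeOfDepth? : ∀ {n} (f : BoolFun n) → Decidable (HasTreeOfDepth f)
hasTreeOfDepth? f d = map′
  (λ { (t , _ , c , eq) → t , c , eq })
  (λ { (t , c , eq) → t , ℕ.≤-reflexive eq , c , eq })
  (anyTree? d λ t → computes? t f ×-dec (depth t ℕ.≟ d))

shift : ∀ {n} → DecisionTree n → DecisionTree (suc n)
shift (leaf b)        = leaf b
shift (query i t₀ t₁) = query (suc i) (shift t₀) (shift t₁)

eval-shift : ∀ {n} (t : DecisionTree n) b x → eval (shift t) (b ∷ x) ≡ eval t x
eval-shift (leaf _)        b x = refl
eval-shift (query i t₀ t₁) b x with lookup x i
... | true  = eval-shift t₁ b x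
... | false = eval-shift t₀ b x

-- Reading every bit computes f.
computingTree : ∀ {n} (f : BoolFun n) → ∃[ t ] Computes t f
computingTree {zero}  f = leaf (f []) , λ { [] → refl }
computingTree {suc n} f
  with computingTree (λ x → f (false ∷ x)) | computingTree (λ x → f (true ∷ x))
... | t₀ , c₀ | t₁ , c₁ = query zero (shift t₀) (shift t₁) , λ where
  (false ∷ x) → trans (eval-shift t₀ false x) (c₀ x)
  (true  ∷ x) → trans (eval-shift t₁ true x) (c₁ x)

least : ∀ {P : ℕ → Set} → Decidable P → ∀ n → P n → ∃ (IsLeast P)
least P? n p with P? 0
least P? n       p | yes p₀ = 0 , p₀ , λ _ _ → z≤n
least P? zero    p | no ¬p₀ = contradiction p ¬p₀
least P? (suc n) p | no ¬p₀ with least (λ k → P? (suc k)) n p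
... | m , pₘ , min = suc m , pₘ , λ where
  zero    p₀ → contradiction p₀ ¬p₀
  (suc k) pₖ → s≤s (min k pₖ)

leastDepth : ∀ {n} (f : BoolFun n) → ∃ (IsLeast (HasTreeOfDepth f))
leastDepth f with computingTree f
... | t , c = least (hasTreeOfDepth? f) (depth t) (t , c , refl)

D : ∀ {n} → BoolFun n → ℕ
D f = proj₁ (leastDepth f)

------------------------------------------------------------------------
-- Asymptotics

TendsToInfinity : (ℕ → ℕ) → Set
TendsToInfinity a = ∀ m → ∃[ i₀ ] ∀ i → i₀ ≤ i → m ≤ a i

fromℕ : ℕ → ℚ
fromℕ n = ℤ.+ n ℚ./ 1

-- A i ≥ c · B i / (log (N i))^C for all large i, with the denominator cleared.
-- When N → ∞, the real constants c > 0, C ≥ 0 and the real logarithm may be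
-- replaced by a rational c > 0, a natural C and ⌊log₂_⌋ without changing the
-- relation: shrink c, round C up, and use log₂ n / 2 ≤ ⌊log₂ n ⌋ ≤ log₂ n for
-- n ≥ 2.
_=Ω̃[_]_ : (A N B : ℕ → ℕ) → Set
A =Ω̃[ N ] B =
  Σ[ c ∈ ℚ ] Σ[ C ∈ ℕ ] (0ℚ ℚ.< c) ×
    (∃[ i₀ ] ∀ i → i₀ ≤ i →
      c ℚ.* fromℕ (B i) ℚ.≤ fromℕ (A i) ℚ.* fromℕ (⌊log₂ N i ⌋ ^ C))

module Submission where

-- F accepts when one of m blocks, each an m × m grid of cells, carries a
-- certificate of the Göös–Pitassi–Watson pointer function: a main column of
-- blank cells except for one head, from which a linked list visits a cell that
-- is not blank in every other column.  Indices live in groups of exponent two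
-- and pointers are displacements, so translations preserve F.  Contents are
-- repeated four times, so two distinct certificates in the same block differ in
-- at least four bits; hence a rejected input has at most one sensitive bit per
-- block and reading origin, and s(F) = Õ(m).  An adversary that answers "blank"
-- except at the last cell of a column, which it links to the previously
-- completed column of the block, keeps F undetermined until all m³ cells are
-- probed, so D(F) ≥ m³.

open import Defs
open import Data.Bool using (Bool; true; false; _xor_; if_then_else_)
open import Data.Bool.Properties as Bool using (xor-assoc; xor-comm; xor-same; xor-identityʳ)
open import Data.Empty using (⊥)
open import Data.Fin as Fin using (Fin; zero; suc; toℕ; fromℕ<)
open import Data.Fin.Permutation as Perm using (Permutation′; permutation; _⟨$⟩ʳ_)
open import Data.Fin.Properties as Fin using (toℕ<n; toℕ-fromℕ<; pigeonhole; *↔×; 2↔Bool)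
open import Data.Integer as ℤ using (+_)
open import Data.Integer.Properties as ℤ using ()
open import Data.List as List using (List; []; _∷_; allFin; filter; length)
open import Data.List.Extrema.Nat using (max≤v⁺)
import Data.List.Membership.DecPropositional as DecMembership
open import Data.List.Membership.Propositional using (_∈_; _∉_)
open import Data.List.Membership.Propositional.Properties
  using (∈-lookup; ∈-filter⁻; ∈-map⁺; ∈-allFin)
open import Data.List.Relation.Unary.All as All using (All; []; _∷_)
open import Data.List.Relation.Unary.All.Properties using (map⁺)
open import Data.List.Relation.Unary.AllPairs using ([]; _∷_)
open import Data.List.Relation.Unary.Any as Any using (here; there)
open import Data.List.Relation.Unary.Any.Properties using (lookup-index)
open import Data.List.Relation.Unary.Unique.Propositional using (Unique)
open import Data.List.Relation.Unary.Unique.Propositional.Properties using (allFin⁺; filter⁺)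
open import Data.Nat using (ℕ; zero; suc; NonZero; _+_; _*_; _^_; _⊔_; _≤_; _<_; z≤n; s<s)
open import Data.Nat.Logarithm using (⌊log₂_⌋; ⌊log₂⌋-mono-≤; ⌊log₂[2^n]⌋≡n)
open import Data.Nat.Properties as ℕ using ()
open import Data.Nat.Solver using (module +-*-Solver)
open import Data.Product using (∃; ∃-syntax; Σ-syntax; _×_; _,_; proj₁; proj₂; map₂)
open import Data.Product.Function.NonDependent.Propositional using (_×-↔_)
open import Data.Rational as ℚ using ()
open import Data.Rational.Properties as ℚ using ()
open import Data.Rational.Unnormalised as ℚᵘ using (mkℚᵘ; *≤*)
open import Data.Rational.Unnormalised.Properties as ℚᵘ using ()
open import Data.Sum using (_⊎_; inj₁; inj₂)
open import Data.Vec using (Vec; []; _∷_; lookup; tabulate; zipWith; replicate; uncons)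
open import Data.Vec.Properties
  using (zipWith-assoc; zipWith-comm; zipWith-identityʳ; lookup∘tabulate; tabulate∘lookup;
         tabulate-cong; lookup∘updateAt′)
open import Function using (_∘_; _↔_; mk↔ₛ′; mk⇔; Inverse; case_of_)
open import Function.Construct.Composition using (_↔-∘_)
open import Function.Construct.Symmetry using (↔-sym)
open import Relation.Binary.Definitions using (DecidableEquality)
open import Relation.Binary.PropositionalEquality
open import Relation.Nullary using (¬_; Dec; yes; no; does; contradiction)
open import Relation.Nullary.Decidable
  using (map′; ¬?; _×-dec_; _→-dec_; does-⇔; dec-true; dec-false; decidable-stable)
open import Relation.Unary using (Decidable)

open Inverse using (to; from; strictlyInverseˡ; strictlyInverseʳ)

-- Finite enumerated groups of exponent two

record BooleanGroup (A : Set) : Set where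
  infixl 6 _⊕_
  field
    order          : ℕ
    number         : A → Fin order
    element        : Fin order → A
    element∘number : ∀ a → element (number a) ≡ a
    number∘element : ∀ i → number (element i) ≡ i
    _⊕_            : A → A → A
    ε              : A
    ⊕-assoc        : ∀ a b c → (a ⊕ b) ⊕ c ≡ a ⊕ (b ⊕ c)
    ⊕-comm         : ∀ a b → a ⊕ b ≡ b ⊕ a
    ⊕-identityʳ    : ∀ a → a ⊕ ε ≡ a
    ⊕-self         : ∀ a → a ⊕ a ≡ ε

  number-injective : ∀ {a b} → number a ≡ number b → a ≡ b
  number-injective eq = trans (sym (element∘number _)) (trans (cong element eq) (element∘number _))

  element-injective : ∀ {i j} → element i ≡ element j → i ≡ j
  element-injective eq = trans (sym (number∘element _)) (trans (cong number eq) (number∘element _))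

  infix 4 _≟_

  abstract
    enumeration : A ↔ Fin order
    enumeration = mk↔ₛ′ number element number∘element element∘number

    _≟_ : DecidableEquality A
    a ≟ b = map′ number-injective (cong number) (number a Fin.≟ number b)

    all? : {P : A → Set} → Decidable P → Dec (∀ a → P a)
    all? {P} P? = map′
      (λ p a → subst P (element∘number a) (p (number a)))
      (λ p i → p (element i))
      (Fin.all? (λ i → P? (element i)))

    any? : {P : A → Set} → Decidable P → Dec (∃ P)
    any? {P} P? = map′
      (λ (i , p) → element i , p)
      (λ (a , p) → number a , subst P (sym (element∘number a)) p)
      (Fin.any? (λ i → P? (element i)))

  ⊕-cancelʳ : ∀ a b → a ⊕ b ⊕ b ≡ a
  ⊕-cancelʳ a b = trans (⊕-assoc a b b) (trans (cong (a ⊕_) (⊕-self b)) (⊕-identityʳ a))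

  ⊕-identityˡ : ∀ a → ε ⊕ a ≡ a
  ⊕-identityˡ a = trans (⊕-comm ε a) (⊕-identityʳ a)

  ⊕-cancelˡ : ∀ a b → a ⊕ (a ⊕ b) ≡ b
  ⊕-cancelˡ a b = trans (⊕-comm a (a ⊕ b)) (trans (cong (_⊕ a) (⊕-comm a b)) (⊕-cancelʳ b a))

  ⊕-swapʳ : ∀ a b c → a ⊕ b ⊕ c ≡ a ⊕ c ⊕ b
  ⊕-swapʳ a b c = trans (⊕-assoc a b c) (trans (cong (a ⊕_) (⊕-comm b c)) (sym (⊕-assoc a c b)))

open BooleanGroup {{...}}

abstract
  vec↔fin : ∀ n → Vec Bool n ↔ Fin (2 ^ n)
  vec↔fin zero    = mk↔ₛ′ (λ _ → zero) (λ _ → []) (λ { zero → refl }) (λ { [] → refl })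
  vec↔fin (suc n) =
    (↔-sym *↔× ↔-∘ (↔-sym 2↔Bool ×-↔ vec↔fin n))
    ↔-∘ mk↔ₛ′ uncons (λ (b , x) → b ∷ x) (λ _ → refl) (λ { (_ ∷ _) → refl })

  product↔fin : ∀ {A B : Set} {m n} → A ↔ Fin m → B ↔ Fin n → (A × B) ↔ Fin (m * n)
  product↔fin A↔m B↔n = ↔-sym *↔× ↔-∘ (A↔m ×-↔ B↔n)

instance
  vecGroup : ∀ {n} → BooleanGroup (Vec Bool n)
  vecGroup {n} = record
    { order          = 2 ^ n
    ; number         = to (vec↔fin n)
    ; element        = from (vec↔fin n)
    ; element∘number = strictlyInverseʳ (vec↔fin n)
    ; number∘element = strictlyInverseˡ (vec↔fin n)
    ; _⊕_            = zipWith _xor_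
    ; ε              = replicate n false
    ; ⊕-assoc        = zipWith-assoc xor-assoc
    ; ⊕-comm         = zipWith-comm xor-comm
    ; ⊕-identityʳ    = zipWith-identityʳ xor-identityʳ
    ; ⊕-self         = zipWith-self
    }
    where
    zipWith-self : ∀ {n} (x : Vec Bool n) → zipWith _xor_ x x ≡ replicate n false
    zipWith-self []      = refl
    zipWith-self (b ∷ x) = cong₂ _∷_ (xor-same b) (zipWith-self x)

  productGroup : ∀ {A B : Set} {{_ : BooleanGroup A}} {{_ : BooleanGroup B}} → BooleanGroup (A × B)
  productGroup {A} {B} = record
    { order          = order {A} * order {B}
    ; number         = to enum
    ; element        = from enum
    ; element∘number = strictlyInverseʳ enum
    ; number∘element = strictlyInverseˡ enum
    ; _⊕_            = λ p r → proj₁ p ⊕ proj₁ r , proj₂ p ⊕ proj₂ r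
    ; ε              = ε , ε
    ; ⊕-assoc        = λ _ _ _ → cong₂ _,_ (⊕-assoc _ _ _) (⊕-assoc _ _ _)
    ; ⊕-comm         = λ _ _ → cong₂ _,_ (⊕-comm _ _) (⊕-comm _ _)
    ; ⊕-identityʳ    = λ _ → cong₂ _,_ (⊕-identityʳ _) (⊕-identityʳ _)
    ; ⊕-self         = λ _ → cong₂ _,_ (⊕-self _) (⊕-self _)
    }
    where enum = product↔fin (enumeration {A}) (enumeration {B})

does⁻ : ∀ {P : Set} (P? : Dec P) → does P? ≡ true → P
does⁻ (yes p) _ = p

another : ∀ {n} .{{_ : NonZero n}} (a : Vec Bool n) → ∃[ b ] b ≢ a
another {suc n} (false ∷ a) = true ∷ a , λ ()
another {suc n} (true  ∷ a) = false ∷ a , λ ()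

-- Counting by pigeonhole

unique⇒lookup≢ : ∀ {A : Set} {xs : List A} → Unique xs →
                 ∀ {i j} → i Fin.< j → List.lookup xs i ≢ List.lookup xs j
unique⇒lookup≢ (x∉ ∷ _) {zero}  {suc j} _         = All.lookup x∉ (∈-lookup j)
unique⇒lookup≢ (_  ∷ u) {suc i} {suc j} (s<s i<j) = unique⇒lookup≢ u i<j

-- The code takes the membership proof because in applications it is extracted from the reason for
-- membership.
length-unique-≤ : ∀ {A B : Set} {{_ : BooleanGroup B}} {xs : List A} → Unique xs →
  (code : ∀ {x} → x ∈ xs → B) → (∀ {x y} (p : x ∈ xs) (r : y ∈ xs) → code p ≡ code r → x ≡ y) →
  length xs ≤ order {B}
length-unique-≤ {xs = xs} unique code injective = ℕ.≮⇒≥ λ short →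
  let i , j , i<j , eq = pigeonhole short (λ i → number (code (∈-lookup {xs = xs} i)))
  in unique⇒lookup≢ unique i<j (injective _ _ (number-injective eq))

order≤length : ∀ {A : Set} {{_ : BooleanGroup A}} (xs : List A) → (∀ a → a ∈ xs) →
               order {A} ≤ length xs
order≤length {A} xs all∈ = ℕ.≮⇒≥ λ short →
  let i , j , i<j , eq = pigeonhole short (λ i → Any.index (at i))
  in Fin.<⇒≢ i<j (element-injective {A} (begin
    element {A} i                      ≡⟨ lookup-index (at i) ⟩
    List.lookup xs (Any.index (at i))  ≡⟨ cong (List.lookup xs) eq ⟩
    List.lookup xs (Any.index (at j))  ≡⟨ lookup-index (at j) ⟨
    element {A} j                      ∎))
  where
  open ≡-Reasoning
  at : ∀ i → element {A} i ∈ xs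
  at i = all∈ (element {A} i)

-- Sensitivity at an input is a length of this form, so bounding it amounts to labelling the
-- sensitive bits injectively.
length-filter-≤ : ∀ {B : Set} {{_ : BooleanGroup B}} {n} {P : Fin n → Set} (P? : Decidable P)
  (code : ∀ {i} → P i → B) → (∀ {i j} (p : P i) (r : P j) → code p ≡ code r → i ≡ j) →
  length (filter P? (allFin n)) ≤ order {B}
length-filter-≤ {n = n} P? code injective = length-unique-≤ (filter⁺ P? (allFin⁺ n))
  (code ∘ holds) (λ p r → injective (holds p) (holds r))
  where
  holds : ∀ {i} → i ∈ filter P? (allFin n) → _
  holds p = proj₂ (∈-filter⁻ P? {xs = allFin n} p)

-- Stabilisers of Boolean functions

module _ {n} (f : BoolFun n) where
  -- With the full stabiliser as the group, transitivity asks only for one invariant permutation per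
  -- pair of indices.
  Stabiliser : Permutation′ n → Set
  Stabiliser σ = ∀ x → f x ≡ f (permute σ x)

  permute-∘ : ∀ (σ τ : Permutation′ n) x → permute σ (permute τ x) ≡ permute (σ Perm.∘ₚ τ) x
  permute-∘ σ τ x = tabulate-cong λ i → lookup∘tabulate _ (σ ⟨$⟩ʳ i)

  permute-cong : ∀ {σ τ : Permutation′ n} → σ Perm.≈ τ → ∀ x → permute σ x ≡ permute τ x
  permute-cong σ≈τ x = tabulate-cong λ i → cong (lookup x) (σ≈τ i)

  stabiliser-isSubgroup : IsSubgroup Stabiliser
  stabiliser-isSubgroup = record
    { resp-≈    = λ {σ} {τ} σ≈τ Gσ x → trans (Gσ x) (cong f (permute-cong {σ} {τ} σ≈τ x))
    ; id-closed = λ x → cong f (sym (tabulate∘lookup x))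
    ; ∘-closed  = λ {σ} {τ} Gσ Gτ x →
        trans (Gτ x) (trans (Gσ (permute τ x)) (cong f (permute-∘ σ τ x)))
    ; ⁻¹-closed = λ {σ} Gσ x → begin
        f x                                      ≡⟨ cong f (tabulate∘lookup x) ⟨
        f (permute Perm.id x)                    ≡⟨ cong f (cancel σ x) ⟨
        f (permute (σ Perm.∘ₚ Perm.flip σ) x)    ≡⟨ cong f (permute-∘ σ (Perm.flip σ) x) ⟨
        f (permute σ (permute (Perm.flip σ) x))  ≡⟨ Gσ _ ⟨
        f (permute (Perm.flip σ) x)              ∎
    }
    where
    open ≡-Reasoning
    cancel : ∀ σ x → permute (σ Perm.∘ₚ Perm.flip σ) x ≡ permute Perm.id x
    cancel σ = permute-cong {σ Perm.∘ₚ Perm.flip σ} {Perm.id} λ _ → Perm.inverseˡ σ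

-- Asymptotic estimates

scaled-≤ : ∀ k a b l → b ≤ suc k * (a * l) → (+ 1 ℚ./ suc k) ℚ.* fromℕ b ℚ.≤ fromℕ a ℚ.* fromℕ l
-- Unnormalised rationals turn the claim into an inequality between integer products.
scaled-≤ k a b l b≤ = ℚ.toℚᵘ-cancel-≤ (begin
  ℚ.toℚᵘ ((+ 1 ℚ./ suc k) ℚ.* fromℕ b)  ≃⟨ lift (+ 1) k (+ b) ⟩
  mkℚᵘ (+ 1) k ℚᵘ.* mkℚᵘ (+ b) 0        ≤⟨ *≤* (subst₂ ℤ._≤_ lhs rhs (ℤ.+≤+ b≤)) ⟩
  mkℚᵘ (+ a) 0 ℚᵘ.* mkℚᵘ (+ l) 0        ≃⟨ lift (+ a) 0 (+ l) ⟨
  ℚ.toℚᵘ (fromℕ a ℚ.* fromℕ l)          ∎)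
  where
  open ℚᵘ.≤-Reasoning
  lift : ∀ x d y → ℚ.toℚᵘ (x ℚ./ suc d ℚ.* (y ℚ./ 1)) ℚᵘ.≃ mkℚᵘ x d ℚᵘ.* mkℚᵘ y 0
  lift x d y = ℚᵘ.≃-trans (ℚ.toℚᵘ-homo-* (x ℚ./ suc d) (y ℚ./ 1))
    (ℚᵘ.*-cong (ℚ.toℚᵘ-fromℚᵘ (mkℚᵘ x d)) (ℚ.toℚᵘ-fromℚᵘ (mkℚᵘ y 0)))
  lhs : + b ≡ (+ 1 ℤ.* + b) ℤ.* + 1
  lhs = sym (trans (ℤ.*-identityʳ _) (ℤ.*-identityˡ (+ b)))
  rhs : + (suc k * (a * l)) ≡ (+ a ℤ.* + l) ℤ.* + (suc k * 1)
  rhs = trans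
    (cong +_ (trans (ℕ.*-comm (suc k) (a * l)) (cong (a * l *_) (sym (ℕ.*-identityʳ (suc k))))))
    (trans (ℤ.pos-* (a * l) _) (cong (ℤ._* + (suc k * 1)) (ℤ.pos-* a l)))

Ω̃-intro : ∀ (A N B : ℕ → ℕ) K C → .{{_ : NonZero K}} →
          (∀ i → B i ≤ K * (A i * ⌊log₂ N i ⌋ ^ C)) → A =Ω̃[ N ] B
Ω̃-intro A N B K@(suc k) C bound =
  + 1 ℚ./ K , C , ℚ.positive⁻¹ _ {{ℚ.normalize-pos 1 K}} , 0 ,
  λ i _ → scaled-≤ k (A i) (B i) (⌊log₂ N i ⌋ ^ C) (bound i)

-- Here `a` stands for the sensitivity, `d` for the query complexity and `l` for the logarithm of
-- the arity. Cubing turns `m` into a quantity below `d`, at the price of a factor `l ^ 3`.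
cube-≤ : ∀ c m p {a d l} → a ≤ c * (m * p) → m * (m * m) ≤ d → p ≤ l → a ^ 3 ≤ c ^ 3 * (d * l ^ 3)
cube-≤ c m p {a} {d} {l} a≤ ≤d p≤l = begin
  a ^ 3                             ≤⟨ ℕ.^-monoˡ-≤ 3 a≤ ⟩
  (c * (m * p)) ^ 3                 ≡⟨ expand c m p ⟩
  c ^ 3 * (m * (m * m) * p ^ 3)     ≤⟨ ℕ.*-monoʳ-≤ (c ^ 3) (ℕ.*-mono-≤ ≤d (ℕ.^-monoˡ-≤ 3 p≤l)) ⟩
  c ^ 3 * (d * l ^ 3)               ∎
  where
  open ℕ.≤-Reasoning
  open +-*-Solver
  expand : ∀ c m p → (c * (m * p)) ^ 3 ≡ c ^ 3 * (m * (m * m) * p ^ 3)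
  expand = solve 3 (λ c m p → (c :* (m :* p)) :^ 3 := c :^ 3 :* (m :* (m :* m) :* p :^ 3)) refl

Ω̃-cube : ∀ (A N B : ℕ → ℕ) c (m p : ℕ → ℕ) → .{{_ : NonZero c}} → (∀ i → B i ≤ c * (m i * p i)) →
         (∀ i → m i * (m i * m i) ≤ A i) → (∀ i → p i ≤ ⌊log₂ N i ⌋) → A =Ω̃[ N ] (λ i → B i ^ 3)
Ω̃-cube A N B c m p B≤ ≤A p≤ = Ω̃-intro A N (λ i → B i ^ 3) (c ^ 3) 3 {{ℕ.m^n≢0 c 3}}
  λ i → cube-≤ c (m i) (p i) (B≤ i) (≤A i) (p≤ i)

-- The pointer function and its certificates

module PointerFunction (q : ℕ) where

  -- The double exponential makes the number of bits of a row or column index, `2 ^ q`, itself the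
  -- order of a Boolean group, so slots can be translated too.
  side : ℕ
  side = 2 ^ 2 ^ q

  -- Position (v , l , s) holds the s-th of the four copies of bit l of cell v.
  Block Column Row Cell Site Slot Position Input : Set
  Block    = Vec Bool (2 ^ q)
  Column   = Vec Bool (2 ^ q)
  Row      = Vec Bool (2 ^ q)
  Cell     = Column × Row
  Site     = Block × Cell
  Slot     = Vec Bool (2 + q)
  Position = Site × Slot × Vec Bool 2
  Input    = Position → Bool

  -- The single true bit pins down the origin from which a blank cell can be read as blank.
  blank : Slot → Bool
  blank l = does (l ≟ ε {Slot})

  -- Every encoding is true here and a blank is false, so this slot tells a head from a blank of the
  -- same kind.
  mark : Slot
  mark = false ∷ true ∷ replicate q false

  -- Slots 00…, 01…, 10…, 11… carry the kind of the cell, the constant true, and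
  -- the column and row parts of a displacement.
  encode : Bool → Cell → Slot → Bool
  encode b d (false ∷ false ∷ _) = b
  encode b d (false ∷ true  ∷ _) = true
  encode b d (true  ∷ false ∷ a) = lookup (proj₁ d) (number a)
  encode b d (true  ∷ true  ∷ a) = lookup (proj₂ d) (number a)

  pointer : (Slot → Bool) → Cell
  pointer w = tabulate (λ i → w (true ∷ false ∷ element {Vec Bool q} i))
            , tabulate (λ i → w (true ∷ true  ∷ element {Vec Bool q} i))

  pointer-cong : ∀ {w w′} → (∀ l → w l ≡ w′ l) → pointer w ≡ pointer w′
  pointer-cong eq = cong₂ _,_ (tabulate-cong λ _ → eq _) (tabulate-cong λ _ → eq _)

  pointer-encode : ∀ b d → pointer (encode b d) ≡ d
  pointer-encode b (d₁ , d₂) = cong₂ _,_ (half d₁) (half d₂)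
    where
    half : ∀ (d : Vec Bool (2 ^ q)) → tabulate (λ i → lookup d (number (element {Vec Bool q} i))) ≡ d
    half d = trans
      (tabulate-cong λ i → cong (lookup d) (number∘element {Vec Bool q} i))
      (tabulate∘lookup d)

  blank-ε : blank ε ≡ true
  blank-ε = dec-true (ε {Slot} ≟ ε) refl

  blank⇒ε : ∀ {l} → blank l ≡ true → l ≡ ε
  blank⇒ε {l} = does⁻ (l ≟ ε {Slot})

  blank-mark : blank mark ≡ false
  blank-mark = dec-false (mark ≟ ε {Slot}) λ ()

  Repeated : Input → Site → Set
  Repeated X v = ∀ l s → X (v , l , s) ≡ X (v , l , ε)

  -- Reading a cell from an arbitrary origin j makes the translations of the slots
  -- symmetries of the function as well.
  content : Input → Slot → Site → Slot → Bool
  content X j v l = X (v , l ⊕ j , ε)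

  record IsBlank (X : Input) (j : Slot) (v : Site) : Set where
    constructor mkBlank
    field
      repeated : Repeated X v
      blanked  : ∀ l → content X j v l ≡ blank l

  -- The bit at `ε` is shared with blank cells and excludes links, the bit at `mark` excludes
  -- blanks; the slots of the displacement stay free.
  record IsHead (X : Input) (j : Slot) (v : Site) : Set where
    constructor mkHead
    field
      repeated : Repeated X v
      at-ε     : content X j v ε ≡ true
      at-mark  : content X j v mark ≡ true

  record IsLink (X : Input) (j : Slot) (v : Site) : Set where
    constructor mkLink
    field
      repeated : Repeated X v
      at-ε     : content X j v ε ≡ false

  step : Input → Slot → Block → Cell → Cell
  step X j β u = u ⊕ pointer (content X j (β , u))

  walk : Input → Slot → Block → Cell → ℕ → Cell
  walk X j β u zero    = u
  walk X j β u (suc t) = step X j β (walk X j β u t)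

  -- A list shorter than side ends in a cell pointing to itself, so the number of
  -- steps can be fixed.
  record Certificate (X : Input) (β : Block) (j : Slot) (c : Column) (ρ : Row) : Set where
    field
      column : ∀ ρ′ → ρ′ ≢ ρ → IsBlank X j (β , c , ρ′)
      head   : IsHead X j (β , c , ρ)
      links  : ∀ (t : Fin side) → IsLink X j (β , walk X j β (c , ρ) (suc (toℕ t)))
      covers : ∀ c′ → c′ ≢ c → ∃[ t ] proj₁ (walk X j β (c , ρ) (suc (toℕ {side} t))) ≡ c′

  Accepts : Input → Set
  Accepts X = ∃[ β ] ∃[ j ] ∃[ c ] ∃[ ρ ] Certificate X β j c ρ

  repeated? : ∀ X → Decidable (Repeated X)
  repeated? X v = all? λ l → all? λ s → X (v , l , s) Bool.≟ X (v , l , ε)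

  certificate? : ∀ X β j c ρ → Dec (Certificate X β j c ρ)
  certificate? X β j c ρ = map′
    (λ (b , (r , x , y) , l , k) → record
      { column = λ ρ′ ne → let r , x = b ρ′ ne in mkBlank r x
      ; head   = mkHead r x y
      ; links  = λ t → let r , x = l t in mkLink r x
      ; covers = k
      })
    (λ K → let open Certificate K in
      (λ ρ′ ne → let mkBlank r x = column ρ′ ne in r , x)
      , (let mkHead r x y = head in r , x , y)
      , (λ t → let mkLink r x = links t in r , x)
      , covers)
    (     (all? λ ρ′ → ¬? (ρ′ ≟ ρ) →-dec
             (repeated? X (β , c , ρ′) ×-dec (all? λ l → content X j (β , c , ρ′) l Bool.≟ blank l)))
    ×-dec (repeated? X (β , c , ρ) ×-dec
             (content X j (β , c , ρ) ε Bool.≟ true) ×-dec (content X j (β , c , ρ) mark Bool.≟ true))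
    ×-dec (Fin.all? λ t → repeated? X (β , w t) ×-dec (content X j (β , w t) ε Bool.≟ false))
    ×-dec (all? λ c′ → ¬? (c′ ≟ c) →-dec Fin.any? λ t → proj₁ (w t) ≟ c′))
    where
    w : Fin side → Cell
    w t = walk X j β (c , ρ) (suc (toℕ t))

  abstract
    accepts? : Decidable Accepts
    accepts? X = any? λ β → any? λ j → any? λ c → any? λ ρ → certificate? X β j c ρ

  -- Certificates under local changes and translations

  Agree : Input → Input → Site → Set
  Agree X Y v = ∀ l s → X (v , l , s) ≡ Y (v , l , s)

  module _ {X Y : Input} {β : Block} {u : Cell} (agree : Agree X Y (β , u)) where
    private v = (β , u)

    repeated-agree : Repeated X v → Repeated Y v
    repeated-agree r l s = trans (sym (agree l s)) (trans (r l s) (agree l ε))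

    content-agree : ∀ j l → content X j v l ≡ content Y j v l
    content-agree j l = agree (l ⊕ j) ε

    blank-agree : ∀ {j} → IsBlank X j v → IsBlank Y j v
    blank-agree (mkBlank r x) =
      mkBlank (repeated-agree r) (λ l → trans (sym (content-agree _ l)) (x l))

    head-agree : ∀ {j} → IsHead X j v → IsHead Y j v
    head-agree (mkHead r x y) =
      mkHead (repeated-agree r) (trans (sym (content-agree _ _)) x) (trans (sym (content-agree _ _)) y)

    link-agree : ∀ {j} → IsLink X j v → IsLink Y j v
    link-agree (mkLink r x) = mkLink (repeated-agree r) (trans (sym (content-agree _ _)) x)

    step-agree : ∀ j → step X j β u ≡ step Y j β u
    step-agree j = cong (u ⊕_) (pointer-cong (content-agree j))

  -- Agreement is asked only along the walk in `X`: inductively the walk in `Y` has not left it.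
  walk-agree : ∀ {X Y} j β u n → (∀ t → t < n → Agree X Y (β , walk X j β u t)) →
               ∀ t → t ≤ n → walk X j β u t ≡ walk Y j β u t
  walk-agree         j β u n agree zero    _   = refl
  walk-agree {X} {Y} j β u n agree (suc t) t<n =
    trans (step-agree {X} {Y} (agree t t<n) j)
          (cong (step Y j β) (walk-agree j β u n agree t (ℕ.<⇒≤ t<n)))

  link-at : ∀ {X β j c ρ} → Certificate X β j c ρ →
            ∀ t → t < side → IsLink X j (β , walk X j β (c , ρ) (suc t))
  link-at {X} {β} {j} {c} {ρ} K t t<m =
    subst (λ n → IsLink X j (β , walk X j β (c , ρ) (suc n))) (toℕ-fromℕ< t<m)
      (Certificate.links K (fromℕ< t<m))

  -- These are the only cells a certificate depends on. The head lies on the column, so the walk is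
  -- listed from its first step.
  data Support (X : Input) (β : Block) (j : Slot) (c : Column) (ρ : Row) : Cell → Set where
    onColumn : ∀ ρ′ → Support X β j c ρ (c , ρ′)
    onWalk   : ∀ (t : Fin side) → Support X β j c ρ (walk X j β (c , ρ) (suc (toℕ t)))

  support-walk : ∀ {X β j c ρ} t → t ≤ side → Support X β j c ρ (walk X j β (c , ρ) t)
  support-walk zero    _   = onColumn _
  support-walk {X} {β} {j} {c} {ρ} (suc t) t<m =
    subst (λ n → Support X β j c ρ (walk X j β (c , ρ) (suc n))) (toℕ-fromℕ< t<m)
      (onWalk (fromℕ< t<m))

  walk-repeated : ∀ {X β j c ρ} → Certificate X β j c ρ →
                  ∀ t → t ≤ side → Repeated X (β , walk X j β (c , ρ) t)
  walk-repeated K zero    _   = IsHead.repeated (Certificate.head K)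
  walk-repeated K (suc t) t<m = IsLink.repeated (link-at K t t<m)

  -- Blanks and heads share the kind `true`, which no link has; this separates a main column from
  -- the walk of another certificate.
  column-at : ∀ {X β j c ρ} → Certificate X β j c ρ →
              ∀ ρ′ → Repeated X (β , c , ρ′) × content X j (β , c , ρ′) ε ≡ true
  column-at {ρ = ρ} K ρ′ with ρ′ ≟ ρ
  ... | yes refl = let mkHead r x _ = Certificate.head K in r , x
  ... | no ne    = let mkBlank r x = Certificate.column K ρ′ ne in r , trans (x ε) blank-ε

  support-repeated : ∀ {X β j c ρ u} → Certificate X β j c ρ → Support X β j c ρ u → Repeated X (β , u)
  support-repeated K (onColumn ρ′) = proj₁ (column-at K ρ′)
  support-repeated K (onWalk t)    = IsLink.repeated (Certificate.links K t)

  certificate-local : ∀ {X Y β j c ρ} → Certificate X β j c ρ →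
                      (∀ u → Support X β j c ρ u → Agree X Y (β , u)) → Certificate Y β j c ρ
  certificate-local {X} {Y} {β} {j} {c} {ρ} K agree = record
    { column = λ ρ′ ne → blank-agree (agree _ (onColumn ρ′)) (column ρ′ ne)
    ; head   = head-agree (agree _ (onColumn ρ)) head
    ; links  = λ t → subst (IsLink Y j ∘ (β ,_)) (same t) (link-agree (agree _ (onWalk t)) (links t))
    ; covers = λ c′ ne → map₂ (λ {t} eq → trans (cong proj₁ (sym (same t))) eq) (covers c′ ne)
    }
    where
    open Certificate K
    same : ∀ (t : Fin side) → walk X j β (c , ρ) (suc (toℕ t)) ≡ walk Y j β (c , ρ) (suc (toℕ t))
    same t = walk-agree {X} {Y} j β (c , ρ) side
      (λ t t<m → agree _ (support-walk t (ℕ.<⇒≤ t<m))) (suc (toℕ t)) (toℕ<n t)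

  accepts-cong : ∀ {X Y} → (∀ p → X p ≡ Y p) → Accepts X → Accepts Y
  accepts-cong eq (β , j , c , ρ , K) = β , j , c , ρ , certificate-local K λ _ _ _ _ → eq _

  module _ (X : Input) (τ : Position) where
    shifted : Input
    shifted p = X (p ⊕ τ)

    private
      τᵛ = proj₁ τ
      τˡ = proj₁ (proj₂ τ)
      τˢ = proj₂ (proj₂ τ)

    shifted-at : ∀ v l s → shifted (v ⊕ τᵛ , l , s) ≡ X (v , l ⊕ τˡ , s ⊕ τˢ)
    shifted-at v l s = cong (λ v′ → X (v′ , _)) (⊕-cancelʳ v τᵛ)

    module _ {v : Site} (r : Repeated X v) where
      repeated-shifted : Repeated shifted (v ⊕ τᵛ)
      repeated-shifted l s = begin
        shifted (v ⊕ τᵛ , l , s)    ≡⟨ shifted-at v l s ⟩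
        X (v , l ⊕ τˡ , s ⊕ τˢ)     ≡⟨ r _ _ ⟩
        X (v , l ⊕ τˡ , ε)          ≡⟨ r _ _ ⟨
        X (v , l ⊕ τˡ , ε ⊕ τˢ)     ≡⟨ shifted-at v l ε ⟨
        shifted (v ⊕ τᵛ , l , ε)    ∎
        where open ≡-Reasoning

      -- The origin `j ⊕ τˡ` absorbs the translation of slots. The copy index also moves, by `τˢ`,
      -- which is harmless because the cell is repeated.
      content-shifted : ∀ j l → content shifted (j ⊕ τˡ) (v ⊕ τᵛ) l ≡ content X j v l
      content-shifted j l = begin
        shifted (v ⊕ τᵛ , l ⊕ (j ⊕ τˡ) , ε)         ≡⟨ shifted-at v _ ε ⟩
        X (v , l ⊕ (j ⊕ τˡ) ⊕ τˡ , ε ⊕ τˢ)          ≡⟨ r _ _ ⟩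
        X (v , l ⊕ (j ⊕ τˡ) ⊕ τˡ , ε)               ≡⟨ cong (λ l′ → X (v , l′ ⊕ τˡ , ε)) (⊕-assoc l j τˡ) ⟨
        X (v , l ⊕ j ⊕ τˡ ⊕ τˡ , ε)                 ≡⟨ cong (λ l′ → X (v , l′ , ε)) (⊕-cancelʳ (l ⊕ j) τˡ) ⟩
        X (v , l ⊕ j , ε)                           ∎
        where open ≡-Reasoning

    module _ {j : Slot} {v : Site} where
      blank-shifted : IsBlank X j v → IsBlank shifted (j ⊕ τˡ) (v ⊕ τᵛ)
      blank-shifted (mkBlank r x) =
        mkBlank (repeated-shifted r) (λ l → trans (content-shifted r j l) (x l))

      head-shifted : IsHead X j v → IsHead shifted (j ⊕ τˡ) (v ⊕ τᵛ)
      head-shifted (mkHead r x y) =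
        mkHead (repeated-shifted r) (trans (content-shifted r j _) x) (trans (content-shifted r j _) y)

      link-shifted : IsLink X j v → IsLink shifted (j ⊕ τˡ) (v ⊕ τᵛ)
      link-shifted (mkLink r x) = mkLink (repeated-shifted r) (trans (content-shifted r j _) x)

    certificate-shifted : ∀ {β j c ρ} → Certificate X β j c ρ →
      Certificate shifted (β ⊕ proj₁ τᵛ) (j ⊕ τˡ) (c ⊕ proj₁ (proj₂ τᵛ)) (ρ ⊕ proj₂ (proj₂ τᵛ))
    certificate-shifted {β} {j} {c} {ρ} K = record
      -- Row `ρ′` of the new column is the translate of row `ρ′ ⊕ τʳ` of the old one, a translation
      -- being its own inverse.
      { column = λ ρ′ ne → subst (λ ρ″ → IsBlank shifted (j ⊕ τˡ) (β ⊕ τᵝ , c ⊕ τᶜ , ρ″))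
                   (⊕-cancelʳ ρ′ τʳ)
                   (blank-shifted (column (ρ′ ⊕ τʳ) λ eq →
                     ne (trans (sym (⊕-cancelʳ ρ′ τʳ)) (cong (_⊕ τʳ) eq))))
      ; head   = head-shifted head
      ; links  = λ t → subst (λ u → IsLink shifted (j ⊕ τˡ) (β ⊕ τᵝ , u))
                   (sym (walk-shifted (suc (toℕ t)) (toℕ<n t))) (link-shifted (links t))
      ; covers = λ c′ ne → map₂
                   (λ {t} eq → trans (cong proj₁ (walk-shifted (suc (toℕ t)) (toℕ<n t)))
                                     (trans (cong (_⊕ τᶜ) eq) (⊕-cancelʳ c′ τᶜ)))
                   (covers (c′ ⊕ τᶜ) λ eq → ne (trans (sym (⊕-cancelʳ c′ τᶜ)) (cong (_⊕ τᶜ) eq)))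
      }
      where
      open Certificate K
      τᵝ = proj₁ τᵛ
      τᵘ = proj₂ τᵛ
      τᶜ = proj₁ τᵘ
      τʳ = proj₂ τᵘ

      walk-shifted : ∀ t → t ≤ side →
        walk shifted (j ⊕ τˡ) (β ⊕ τᵝ) ((c , ρ) ⊕ τᵘ) t ≡ walk X j β (c , ρ) t ⊕ τᵘ
      walk-shifted zero    _   = refl
      walk-shifted (suc t) t<m = begin
        step shifted (j ⊕ τˡ) (β ⊕ τᵝ) (walk shifted (j ⊕ τˡ) (β ⊕ τᵝ) ((c , ρ) ⊕ τᵘ) t)
          ≡⟨ cong (step shifted (j ⊕ τˡ) (β ⊕ τᵝ)) (walk-shifted t (ℕ.<⇒≤ t<m)) ⟩
        step shifted (j ⊕ τˡ) (β ⊕ τᵝ) (w ⊕ τᵘ)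
          ≡⟨ cong (w ⊕ τᵘ ⊕_) (pointer-cong (content-shifted (walk-repeated K t (ℕ.<⇒≤ t<m)) j)) ⟩
        w ⊕ τᵘ ⊕ pointer (content X j (β , w))
          ≡⟨ ⊕-swapʳ w τᵘ _ ⟩
        step X j β w ⊕ τᵘ ∎
        where
        open ≡-Reasoning
        w = walk X j β (c , ρ) t

  accepts-shifted : ∀ X τ → Accepts X → Accepts (shifted X τ)
  accepts-shifted X τ (β , j , c , ρ , K) = _ , _ , _ , _ , certificate-shifted X τ K

  -- If the contents at v differed, X and Y would differ in all four copies of a slot.
  repeated⇒agree : ∀ {X Y i₁ i₂ v} → (∀ p → p ≢ i₁ → p ≢ i₂ → X p ≡ Y p) →
                   Repeated X v → Repeated Y v → Agree X Y v
  repeated⇒agree {X} {Y} {i₁} {i₂} {v} same rX rY l s with X (v , l , ε) Bool.≟ Y (v , l , ε)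
  ... | yes eq = trans (rX l s) (trans eq (sym (rY l s)))
  ... | no  ne = contradiction (hit s₃) (crowded (hit s₁) (hit s₂))
    where
    s₁ s₂ s₃ : Vec Bool 2
    s₁ = true ∷ true ∷ []
    s₂ = true ∷ false ∷ []
    s₃ = false ∷ true ∷ []
    s₁≢s₂ : s₁ ≢ s₂
    s₁≢s₂ ()
    s₁≢s₃ : s₁ ≢ s₃
    s₁≢s₃ ()
    s₂≢s₃ : s₂ ≢ s₃
    s₂≢s₃ ()

    Hit : Vec Bool 2 → Set
    Hit s = (v , l , s) ≡ i₁ ⊎ (v , l , s) ≡ i₂

    hit : ∀ s → Hit s
    hit s with (v , l , s) ≟ i₁ | (v , l , s) ≟ i₂
    ... | yes eq | _      = inj₁ eq
    ... | _      | yes eq = inj₂ eq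
    ... | no ne₁ | no ne₂ = contradiction (trans (sym (rX l s)) (trans (same _ ne₁ ne₂) (rY l s))) ne

    clash : ∀ {s s′ : Vec Bool 2} {i : Position} → s ≢ s′ → (v , l , s) ≡ i → (v , l , s′) ≡ i → ⊥
    clash ne refl refl = ne refl

    -- Of three distinct copies, two would have to occupy the same exceptional position.
    crowded : Hit s₁ → Hit s₂ → ¬ Hit s₃
    crowded (inj₁ a) (inj₁ b) _        = clash s₁≢s₂ a b
    crowded (inj₂ a) (inj₂ b) _        = clash s₁≢s₂ a b
    crowded (inj₁ a) (inj₂ b) (inj₁ c) = clash s₁≢s₃ a c
    crowded (inj₁ a) (inj₂ b) (inj₂ c) = clash s₂≢s₃ b c
    crowded (inj₂ a) (inj₁ b) (inj₁ c) = clash s₂≢s₃ b c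
    crowded (inj₂ a) (inj₁ b) (inj₂ c) = clash s₁≢s₃ a c

  -- Uniqueness of a certificate within a block and an origin

  module _ {Y Z : Input} {β : Block} {j : Slot}
           (agree : ∀ u → Repeated Y (β , u) → Repeated Z (β , u) → Agree Y Z (β , u)) where

    -- Otherwise the walk of the first certificate meets column `c₂` in a link, of kind `false`,
    -- while the second certificate gives that cell kind `true`. Both certificates make the cell
    -- repeated, so the inputs agree on it.
    same-column : ∀ {c₁ ρ₁ c₂ ρ₂} → Certificate Y β j c₁ ρ₁ → Certificate Z β j c₂ ρ₂ → c₂ ≡ c₁
    same-column {c₁} {ρ₁} {c₂} {ρ₂} K L with c₂ ≟ c₁
    ... | yes eq = eq
    ... | no ne with Certificate.covers K c₂ ne
    ...   | t , refl = contradiction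
      (trans (sym at-ε) (trans (content-agree {Y} {Z} (agree _ repeated (proj₁ at)) j ε) (proj₂ at)))
      λ ()
      where
      open IsLink (Certificate.links K t)
      at = column-at L (proj₂ (walk Y j β (c₁ , ρ₁) (suc (toℕ t))))

    -- Otherwise the head of the first certificate is a blank of the second, and the two disagree at
    -- `mark`.
    same-row : ∀ {c ρ₁ ρ₂} → Certificate Y β j c ρ₁ → Certificate Z β j c ρ₂ → ρ₁ ≡ ρ₂
    same-row {c} {ρ₁} {ρ₂} K L with ρ₁ ≟ ρ₂
    ... | yes eq = eq
    ... | no ne  = contradiction
      (trans (sym at-mark) (trans
        (content-agree {Y} {Z} (agree _ repeated (IsBlank.repeated b)) j mark)
        (trans (IsBlank.blanked b mark) blank-mark)))
      λ ()
      where
      open IsHead (Certificate.head K)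
      b = Certificate.column L ρ₁ ne

    same-walk : ∀ {c ρ} → Certificate Y β j c ρ → Certificate Z β j c ρ →
                ∀ t → t ≤ side → walk Y j β (c , ρ) t ≡ walk Z j β (c , ρ) t
    same-walk         K L zero    _   = refl
    same-walk {c} {ρ} K L (suc t) t<m = trans
      (step-agree {Y} {Z} (agree _ (walk-repeated K t (ℕ.<⇒≤ t<m))
        (subst (λ u → Repeated Z (β , u)) (sym eq) (walk-repeated L t (ℕ.<⇒≤ t<m)))) j)
      (cong (step Z j β) eq)
      where eq = same-walk K L t (ℕ.<⇒≤ t<m)

    support-agree : ∀ {c ρ} → Certificate Y β j c ρ → Certificate Z β j c ρ →
                    ∀ u → Support Y β j c ρ u → Agree Y Z (β , u)
    support-agree K L _ S@(onColumn ρ′) = agree _ (support-repeated K S) (proj₁ (column-at L ρ′))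
    support-agree K L _ S@(onWalk t)    = agree _ (support-repeated K S)
      (subst (λ u → Repeated Z (β , u)) (sym (same-walk K L (suc (toℕ t)) (toℕ<n t)))
        (support-repeated L (onWalk t)))

  -- Y and Z agree on the support of their common certificate, and X agrees
  -- with one of them at every position.
  near-certificate : ∀ {X Y Z i₁ i₂ β j c₁ ρ₁ c₂ ρ₂} → i₁ ≢ i₂ →
    (∀ p → p ≢ i₁ → X p ≡ Y p) → (∀ p → p ≢ i₂ → X p ≡ Z p) →
    Certificate Y β j c₁ ρ₁ → Certificate Z β j c₂ ρ₂ → Certificate X β j c₁ ρ₁
  near-certificate {X} {Y} {Z} {i₁} {i₂} {β} {j} {c₁} {ρ₁} i₁≢i₂ X≈Y X≈Z K L
    = certificate-local K λ u S l s → sym (at u S l s)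
    where
    agree : ∀ u → Repeated Y (β , u) → Repeated Z (β , u) → Agree Y Z (β , u)
    agree _ = repeated⇒agree λ p ne₁ ne₂ → trans (sym (X≈Y p ne₁)) (X≈Z p ne₂)

    L′ : Certificate Z β j c₁ ρ₁
    L′ with same-column agree K L
    ... | refl with same-row agree K L
    ...   | refl = L

    at : ∀ u → Support Y β j c₁ ρ₁ u → Agree X Y (β , u)
    at u S l s with ((β , u) , l , s) ≟ i₁
    ... | no ne    = X≈Y _ ne
    ... | yes refl = trans (X≈Z _ i₁≢i₂) (sym (support-agree agree K L′ u S l s))

  -- Transitivity and sensitivity

  arity : ℕ
  arity = order {Position}

  view : Vec Bool arity → Input
  view x p = lookup x (number {Position} p)

  pointerFunction : BoolFun arity
  pointerFunction x = does (accepts? (view x))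

  translation : Position → Permutation′ arity
  translation τ = permutation translate translate translate-involutive translate-involutive
    where
    translate : Fin arity → Fin arity
    translate i = number {Position} (element {Position} i ⊕ τ)
    translate-involutive : ∀ i → translate (translate i) ≡ i
    translate-involutive i = trans
      (cong (λ p → number {Position} (p ⊕ τ)) (element∘number {Position} _))
      (trans (cong (number {Position}) (⊕-cancelʳ (element {Position} i) τ))
             (number∘element {Position} i))

  view-translation : ∀ τ x p → view (permute (translation τ) x) p ≡ shifted (view x) τ p
  view-translation τ x p = trans (lookup∘tabulate _ (number {Position} p))
    (cong (λ p′ → lookup x (number {Position} (p′ ⊕ τ))) (element∘number {Position} p))

  pointerFunction-transitive : Transitive pointerFunction
  pointerFunction-transitive =
    Stabiliser pointerFunction , stabiliser-isSubgroup pointerFunction ,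
    moves , λ _ invariant → invariant
    where
    translation-invariant : ∀ τ → Stabiliser pointerFunction (translation τ)
    translation-invariant τ x = does-⇔
      (mk⇔ (λ acc → accepts-cong (λ p → sym (view-translation τ x p))
             (accepts-shifted (view x) τ acc))
           -- A second shift by `τ` undoes the first, so the converse is the same implication again.
           (λ acc → accepts-cong (λ p → cong (view x) (⊕-cancelʳ p τ))
             (accepts-shifted _ τ (accepts-cong (view-translation τ x) acc))))
      (accepts? _) (accepts? _)

    moves : TransitiveGroup (Stabiliser pointerFunction)
    moves i j = translation τ , translation-invariant τ ,
      trans (cong (number {Position}) (⊕-cancelˡ (element {Position} i) (element {Position} j)))
            (number∘element {Position} j)
      where τ = element {Position} i ⊕ element {Position} j

  view-flipBit : ∀ x i p → p ≢ element {Position} i → view x p ≡ view (flipBit x i) p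
  view-flipBit x i p ne = sym (lookup∘updateAt′ (number {Position} p) i
    (λ eq → ne (trans (sym (element∘number {Position} p)) (cong (element {Position}) eq))) x)

  -- Labels for the bits in the support of a certificate. The first component names one of 2 ·
  -- `side` cells: its leading bit chooses between the main column and the walk.
  Place : Set
  Place = Vec Bool (suc (2 ^ q)) × Slot × Vec Bool 2

  module _ (β : Block) (j : Slot) (c : Column) (ρ : Row) (X : Input) where
    supportCell : Vec Bool (suc (2 ^ q)) → Cell
    supportCell (false ∷ ρ′) = c , ρ′
    supportCell (true  ∷ a)  = walk X j β (c , ρ) (suc (toℕ (number {Row} a)))

    place : Place → Position
    place (a , l , s) = (β , supportCell a) , l , s

    supportCell-onto : ∀ {u} → Support X β j c ρ u → ∃[ a ] supportCell a ≡ u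
    supportCell-onto (onColumn ρ′) = false ∷ ρ′ , refl
    supportCell-onto (onWalk t)    =
      true ∷ element {Row} t ,
      cong (λ t → walk X j β (c , ρ) (suc (toℕ t))) (number∘element {Row} t)

    -- A change outside the support would leave the certificate intact.
    sensitive-place : ∀ {Y} → Certificate X β j c ρ → ¬ Accepts Y →
                      ∀ p → (∀ p′ → p′ ≢ p → X p′ ≡ Y p′) → ∃[ a ] place a ≡ p
    sensitive-place {Y} K Y-rejects p X≈Y with any? (λ a → place a ≟ p)
    ... | yes found = found
    ... | no unfound = contradiction (β , j , c , ρ , certificate-local K agree) Y-rejects
      where
      agree : ∀ u → Support X β j c ρ u → Agree X Y (β , u)
      agree u S l s = X≈Y _ λ eq → let a , eq′ = supportCell-onto S in
        unfound ((a , l , s) , trans (cong (λ u → (β , u) , l , s) eq′) eq)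

  -- At an accepted input all sensitive bits lie in the support of one certificate. At a rejected
  -- input each sensitive bit is tagged with the block and origin of the certificate its flip
  -- creates; by `near-certificate` two bits with one tag would make the input itself accepted.
  sensitivityAt-≤ : ∀ x → sensitivityAt pointerFunction x ≤ order {Place}
  sensitivityAt-≤ x = case accepts? (view x) of λ where
      (yes (_ , _ , _ , _ , K)) → accepting K
      (no rejects)              → rejecting rejects
    where
    Sensitive : Fin arity → Set
    Sensitive i = pointerFunction x ≢ pointerFunction (flipBit x i)

    sensitive? : Decidable Sensitive
    sensitive? i = ¬? (pointerFunction x Bool.≟ pointerFunction (flipBit x i))

    accepting : ∀ {β j c ρ} → Certificate (view x) β j c ρ →
                length (filter sensitive? (allFin arity)) ≤ order {Place}
    accepting {β} {j} {c} {ρ} K = length-filter-≤ sensitive? (λ ne → proj₁ (hit ne)) λ ne ne′ eq →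
      element-injective {Position} (trans (sym (proj₂ (hit ne))) (trans (cong place′ eq) (proj₂ (hit ne′))))
      where
      place′ : Place → Position
      place′ = place β j c ρ (view x)
      hit : ∀ {i} → Sensitive i → ∃[ a ] place′ a ≡ element {Position} i
      hit {i} ne = sensitive-place β j c ρ (view x) K
        (λ acc → ne (trans (dec-true (accepts? _) (_ , _ , _ , _ , K)) (sym (dec-true (accepts? _) acc))))
        (element {Position} i) (view-flipBit x i)

    tag : ∀ {X} → Accepts X → Block × Slot
    tag (β , j , _) = β , j

    collision : ∀ {i i′} → i ≢ i′ → (acc : Accepts (view (flipBit x i))) (acc′ : Accepts (view (flipBit x i′))) →
                tag acc ≡ tag acc′ → Accepts (view x)
    collision {i} {i′} i≢i′ (β , j , _ , _ , K) (_ , _ , _ , _ , L) refl = β , j , _ , _ ,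
      near-certificate (i≢i′ ∘ element-injective {Position}) (view-flipBit x i) (view-flipBit x i′) K L

    rejecting : ¬ Accepts (view x) → length (filter sensitive? (allFin arity)) ≤ order {Place}
    rejecting rejects = ℕ.≤-trans
      (length-filter-≤ sensitive? (tag ∘ flipped)
        λ p r eq → decidable-stable (_ Fin.≟ _) λ i≢i′ → rejects (collision i≢i′ (flipped p) (flipped r) eq))
      (ℕ.*-mono-≤ (ℕ.^-monoʳ-≤ 2 (ℕ.n≤1+n (2 ^ q))) (ℕ.m≤m*n (order {Slot}) 4))
      where
      flipped : ∀ {i} → Sensitive i → Accepts (view (flipBit x i))
      flipped ne = decidable-stable (accepts? _) λ rejects′ →
        ne (trans (dec-false (accepts? _) rejects) (sym (dec-false (accepts? _) rejects′)))

  s-≤ : s pointerFunction ≤ order {Place}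
  s-≤ = max≤v⁺ z≤n (map⁺ (All.universal sensitivityAt-≤ (inputs arity)))

  -- The adversary

  open DecMembership (_≟_ {Site}) using (_∈?_)

  private instance
    2^q≢0 : NonZero (2 ^ q)
    2^q≢0 = ℕ.m^n≢0 2 q

  Closes : List Site → Site → Set
  Closes h (β , c , ρ) = ∀ ρ′ → ρ′ ≢ ρ → (β , c , ρ′) ∈ h

  closes? : ∀ h v → Dec (Closes h v)
  closes? h (β , c , ρ) = all? λ ρ′ → ¬? (ρ′ ≟ ρ) →-dec ((β , c , ρ′) ∈? h)

  -- Histories list the latest site first, so the tail below `v` is what had been probed when `v`
  -- was answered. Later probes do not affect the property.
  data Closed : List Site → Site → Set where
    here  : ∀ {h v} → Closes h v → Closed (v ∷ h) v
    there : ∀ {h v w} → Closed h v → Closed (w ∷ h) v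

  -- The closing cells of the block, latest first, which is the order in which their pointers run.
  chain : List Site → Block → List Cell
  chain []            β = []
  chain ((β′ , u) ∷ h) β with closes? h (β′ , u) | β′ ≟ β
  ... | yes _ | yes _ = u ∷ chain h β
  ... | _     | _     = chain h β

  latest : List Cell → Cell → Cell
  latest []      u = u
  latest (z ∷ _) _ = z

  -- A site is answered blank unless it is the last of its column; then it points to
  -- the last site that completed a column of the block, or to itself if it is the
  -- first to do so.
  reply : List Site → Site → Slot → Bool
  reply h (β , u) with closes? h (β , u)
  ... | yes _ = encode false (u ⊕ latest (chain h β) u)
  ... | no  _ = blank

  -- The adversary commits to all slots and copies of a site at once, so histories consist of sites
  -- rather than bits.
  data Follows (X : Input) : List Site → Set where
    []  : Follows X []
    _∷_ : ∀ {v h} → (∀ l s → X (v , l , s) ≡ reply h v l) → Follows X h → Follows X (v ∷ h)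

  closed-column : ∀ {h β c ρ} → Closed h (β , c , ρ) → ∀ ρ′ → (β , c , ρ′) ∈ h
  closed-column {ρ = ρ} (here closes) ρ′ with ρ′ ≟ ρ
  ... | yes refl = here refl
  ... | no ne    = there (closes ρ′ ne)
  closed-column (there closed) ρ′ = there (closed-column closed ρ′)

  -- The earlier of two closing sites would find the later one already in its history, against
  -- uniqueness.
  closed-unique : ∀ {h β c ρ ρ′} → Unique h → Closed h (β , c , ρ) → Closed h (β , c , ρ′) → ρ ≡ ρ′
  closed-unique _        (here _)  (here _)  = refl
  closed-unique (v∉ ∷ _) (here _)  (there d) = contradiction refl (All.lookup v∉ (closed-column d _))
  closed-unique (v∉ ∷ _) (there d) (here _)  = contradiction refl (All.lookup v∉ (closed-column d _))
  closed-unique (_ ∷ u)  (there d) (there e) = closed-unique u d e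

  -- Entries are removed as long as the tail still contains the whole column; the first one whose
  -- removal leaves a gap closes the column.
  complete⇒closed : ∀ h {β c} → (∀ ρ → (β , c , ρ) ∈ h) → ∃[ ρ ] Closed h (β , c , ρ)
  complete⇒closed []      complete = contradiction (complete ε) λ ()
  complete⇒closed (v ∷ h) {β} {c} complete with any? (λ ρ → ¬? ((β , c , ρ) ∈? h))
  ... | no ¬missing = map₂ there (complete⇒closed h λ ρ →
          decidable-stable ((β , c , ρ) ∈? h) λ ∉h → ¬missing (ρ , ∉h))
  ... | yes (ρ , ∉h) with complete ρ
  ...   | there ∈h  = contradiction ∈h ∉h
  ...   | here refl = ρ , here closes
    where
    closes : Closes h (β , c , ρ)
    closes ρ′ ne with complete ρ′
    ... | here refl = contradiction refl ne
    ... | there ∈h  = ∈h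

  chain⇒closed : ∀ h {β u} → u ∈ chain h β → Closed h (β , u)
  chain⇒closed ((β′ , u) ∷ h) {β} ∈chain with closes? h (β′ , u) | β′ ≟ β | ∈chain
  ... | yes closes | yes refl | here refl = here closes
  ... | yes _      | yes refl | there ∈c  = there (chain⇒closed h ∈c)
  ... | yes _      | no _     | ∈c        = there (chain⇒closed h ∈c)
  ... | no _       | yes _    | ∈c        = there (chain⇒closed h ∈c)
  ... | no _       | no _     | ∈c        = there (chain⇒closed h ∈c)

  closed⇒chain : ∀ {h β u} → Closed h (β , u) → u ∈ chain h β
  closed⇒chain {(β , u) ∷ h} (here closes) with closes? h (β , u) | β ≟ β
  ... | yes _     | yes _ = here refl
  ... | yes _     | no ne = contradiction refl ne
  ... | no ¬closes | _    = contradiction closes ¬closes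
  closed⇒chain {(β′ , u) ∷ h} {β} (there closed) with closes? h (β′ , u) | β′ ≟ β
  ... | yes _ | yes _ = there (closed⇒chain closed)
  ... | yes _ | no _  = closed⇒chain closed
  ... | no _  | yes _ = closed⇒chain closed
  ... | no _  | no _  = closed⇒chain closed

  chain-unique : ∀ {h} β → Unique h → Unique (chain h β)
  chain-unique {[]}           β []        = []
  chain-unique {(β′ , u) ∷ h} β (v∉ ∷ uniq) with closes? h (β′ , u) | β′ ≟ β
  ... | yes _ | yes refl = All.tabulate (λ { ∈c refl → All.lookup v∉ (closed-column (chain⇒closed h ∈c) _) refl })
                         ∷ chain-unique β uniq
  ... | yes _ | no _     = chain-unique β uniq
  ... | no _  | yes _    = chain-unique β uniq
  ... | no _  | no _     = chain-unique β uniq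

  -- Each column is closed at most once. Hence `side` steps traverse the whole list.
  length-chain : ∀ {h} β → Unique h → length (chain h β) ≤ side
  length-chain {h} β uniq = length-unique-≤ {B = Column} (chain-unique β uniq) (λ {u} _ → proj₁ u)
    λ { p r refl → cong (_ ,_) (closed-unique uniq (chain⇒closed h p) (chain⇒closed h r)) }

  -- Walking along the adversary's linked list

  content-ε : ∀ X v l → content X ε v l ≡ X (v , l , ε)
  content-ε X v l = cong (λ l′ → X (v , l′ , ε)) (⊕-identityʳ l)

  module _ {X : Input} {β : Block} {u : Cell} where
    blankSite : (∀ l s → X ((β , u) , l , s) ≡ blank l) → IsBlank X ε (β , u)
    blankSite eq = mkBlank (λ l s → trans (eq l s) (sym (eq l ε))) λ l → trans (content-ε X _ l) (eq l ε)

    module _ {b : Bool} {u′ : Cell} (eq : ∀ l s → X ((β , u) , l , s) ≡ encode b (u ⊕ u′) l) where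
      encoded-repeated : Repeated X (β , u)
      encoded-repeated l s = trans (eq l s) (sym (eq l ε))

      encoded-content : ∀ l → content X ε (β , u) l ≡ encode b (u ⊕ u′) l
      encoded-content l = trans (content-ε X _ l) (eq l ε)

      encoded-step : step X ε β u ≡ u′
      encoded-step = begin
        u ⊕ pointer (content X ε (β , u)) ≡⟨ cong (u ⊕_) (pointer-cong encoded-content) ⟩
        u ⊕ pointer (encode b (u ⊕ u′))   ≡⟨ cong (u ⊕_) (pointer-encode b _) ⟩
        u ⊕ (u ⊕ u′)                      ≡⟨ ⊕-cancelˡ u u′ ⟩
        u′                                ∎
        where open ≡-Reasoning

  data Linked (X : Input) (β : Block) : List Cell → Set where
    []   : Linked X β []
    link : ∀ {z zs} → IsLink X ε (β , z) → step X ε β z ≡ latest zs z → Linked X β zs → Linked X β (z ∷ zs)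

  linked : ∀ {X h} β → Follows X h → Linked X β (chain h β)
  linked β [] = []
  linked {X} {(β′ , u) ∷ h} β (eq ∷ follows) with closes? h (β′ , u) | β′ ≟ β
  ... | yes closes | yes refl = link
    (mkLink (encoded-repeated {X} eq) (encoded-content {X} eq ε)) (encoded-step {X} eq) (linked β follows)
  ... | yes _ | no _  = linked β follows
  ... | no _  | yes _ = linked β follows
  ... | no _  | no _  = linked β follows

  walk-suc : ∀ X j β u t → walk X j β u (suc t) ≡ walk X j β (step X j β u) t
  walk-suc X j β u zero    = refl
  walk-suc X j β u (suc t) = cong (step X j β) (walk-suc X j β u t)

  linked-walk : ∀ {X β z zs} → Linked X β (z ∷ zs) → ∀ t → IsLink X ε (β , walk X ε β z t)
  linked-walk (link isLink _ _) zero = isLink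
  -- The last cell points to itself, so the walk stays there for all remaining steps.
  linked-walk {X} {β} {z} {[]} L@(link _ next _) (suc t) =
    subst (IsLink X ε ∘ (β ,_))
      (sym (trans (walk-suc X ε β z t) (cong (λ u → walk X ε β u t) next))) (linked-walk L t)
  linked-walk {X} {β} {z} {z′ ∷ zs} (link _ next L) (suc t) =
    subst (IsLink X ε ∘ (β ,_))
      (sym (trans (walk-suc X ε β z t) (cong (λ u → walk X ε β u t) next))) (linked-walk L t)

  linked-reaches : ∀ {X β z zs u} → Linked X β (z ∷ zs) → (i : u ∈ z ∷ zs) →
                   walk X ε β z (toℕ (Any.index i)) ≡ u
  linked-reaches _ (here refl) = refl
  linked-reaches {X} {β} {z} {z′ ∷ zs} (link _ next L) (there i) = trans
    (walk-suc X ε β z _)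
    (trans (cong (λ u → walk X ε β u (toℕ (Any.index i))) next) (linked-reaches L i))

  -- Neither alternative is a head read from origin `ε`: the first fails at `mark`, the second at
  -- `ε`.
  Status : Input → List Site → Site → Set
  Status X h v = (∀ l s → X (v , l , s) ≡ blank l) ⊎ (Closed h v × X (v , ε , ε) ≡ false)

  status : ∀ {X h v} → Follows X h → v ∈ h → Status X h v
  status {h = v ∷ h} (eq ∷ _) (here refl) with closes? h v
  ... | yes closes = inj₂ (here closes , eq ε ε)
  ... | no ¬closes = inj₁ eq
  status (_ ∷ follows) (there v∈h) with status follows v∈h
  ... | inj₁ blanks       = inj₁ blanks
  ... | inj₂ (closed , x) = inj₂ (there closed , x)

  -- The two ways to answer the last open site

  module _ {X : Input} {h : List Site} (uniq : Unique h) (follows : Follows X h)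
           {β : Block} {c : Column} {ρ : Row} (w∉h : (β , c , ρ) ∉ h)
           (full : ∀ v → v ≢ (β , c , ρ) → v ∈ h) where

    open-column : ∀ ρ′ → ρ′ ≢ ρ → IsBlank X ε (β , c , ρ′)
    open-column ρ′ ne with status follows (full (β , c , ρ′) λ { refl → ne refl })
    ... | inj₁ blanks       = blankSite {X} blanks
    ... | inj₂ (closed , _) = contradiction (closed-column closed ρ) w∉h

    -- The column of the open site was never closed, so its other cells are blank. Every other
    -- column is complete, so its closing cell lies on the chain that the new head points to.
    certificate :
      (∀ l s → X ((β , c , ρ) , l , s) ≡ encode true ((c , ρ) ⊕ latest (chain h β) (c , ρ)) l) →
      Certificate X β ε c ρ
    certificate head = record
      { column = open-column
      ; head   = mkHead
          (encoded-repeated {X} head) (encoded-content {X} head ε) (encoded-content {X} head mark)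
      ; links  = links (chain h β) refl (linked β follows)
      ; covers = covers
      }
      where
      closed-elsewhere : ∀ c′ → c′ ≢ c → ∃[ ρ′ ] (c′ , ρ′) ∈ chain h β
      closed-elsewhere c′ ne = map₂ closed⇒chain
        (complete⇒closed h λ ρ′ → full (β , c′ , ρ′) λ { refl → ne refl })

      walk-head : ∀ {z zs} → chain h β ≡ z ∷ zs → ∀ t → walk X ε β (c , ρ) (suc t) ≡ walk X ε β z t
      walk-head eq t = trans (walk-suc X ε β (c , ρ) t)
        (cong (λ u → walk X ε β u t) 
          (trans (encoded-step {X} head) (cong (λ zs → latest zs (c , ρ)) eq)))

      links : ∀ zs → chain h β ≡ zs → Linked X β zs →
              ∀ (t : Fin side) → IsLink X ε (β , walk X ε β (c , ρ) (suc (toℕ t)))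
      -- The chain is not empty: there is a second column, and it has been closed.
      links [] eq _ t =
        let c′ , ne = another c
            ρ′ , ∈chain = closed-elsewhere c′ ne
        in contradiction (subst (λ zs → (c′ , ρ′) ∈ zs) eq ∈chain) λ ()
      links (z ∷ zs) eq L t =
        subst (IsLink X ε ∘ (β ,_)) (sym (walk-head eq (toℕ t))) (linked-walk L (toℕ t))

      reach : ∀ {u} zs → chain h β ≡ zs → Linked X β zs → length zs ≤ side → u ∈ zs →
              ∃[ t ] walk X ε β (c , ρ) (suc (toℕ {side} t)) ≡ u
      -- The first step leads from the head to the front of the chain, so the member of index i is
      -- reached after i + 1 steps.
      reach (z ∷ zs) eq L short i = fromℕ< t<side , trans
        (walk-head eq _)
        (trans (cong (walk X ε β z) (toℕ-fromℕ< t<side)) (linked-reaches L i))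
        where t<side = ℕ.≤-trans (toℕ<n (Any.index i)) short

      covers : ∀ c′ → c′ ≢ c → ∃[ t ] proj₁ (walk X ε β (c , ρ) (suc (toℕ {side} t))) ≡ c′
      covers c′ ne = let _ , ∈chain = closed-elsewhere c′ ne in
        map₂ (cong proj₁) (reach (chain h β) refl (linked β follows) (length-chain β uniq) ∈chain)

    -- From an origin j ≠ ε a blank cell no longer reads as blank, and a column has at
    -- most one other cell.
    rejects : (∀ l s → X ((β , c , ρ) , l , s) ≡ blank l) → ¬ Accepts X
    rejects blanks (β′ , j , c′ , ρ′ , K) = refute (anyStatus _)
      where
      open Certificate K
      open IsHead head

      anyStatus : ∀ v → Status X h v
      anyStatus v with v ≟ (β , c , ρ)
      ... | yes refl = inj₁ blanks
      ... | no ne    = status follows (full v ne)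

      blank⇒unshifted : ∀ {l} → blank (l ⊕ j) ≡ true → l ≡ j
      blank⇒unshifted {l} eq =
        trans (sym (⊕-cancelʳ l j)) (trans (cong (_⊕ j) (blank⇒ε eq)) (⊕-identityˡ j))

      refute : ¬ Status X h (β′ , c′ , ρ′)
      -- A cell answered blank is true at one slot only, so `mark` and `ε` would both equal `j`.
      refute (inj₁ eq) = contradiction
        (trans (blank⇒unshifted (trans (sym (eq _ _)) at-mark))
               (sym (blank⇒unshifted (trans (sym (eq _ _)) at-ε))))
        λ ()
      refute (inj₂ (closed , low)) with j ≟ ε | another ρ′
      ... | yes refl | _ = contradiction (trans (sym at-ε) (trans (content-ε X _ ε) low)) λ ()
      ... | no j≢ε | ρ″ , ne with anyStatus (β′ , c′ , ρ″)
      ...   | inj₁ eq = j≢ε (sym (blank⇒unshifted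
                (trans (sym (eq _ _)) (trans (IsBlank.blanked (column ρ″ ne) ε) blank-ε))))
      ...   | inj₂ (closed′ , _) = ne (closed-unique uniq closed′ closed)

  -- Playing a decision tree against the adversary

  infix 4 _⊑_
  data _⊑_ (h : List Site) : List Site → Set where
    refl : h ⊑ h
    grow : ∀ {v H} → h ⊑ H → h ⊑ v ∷ H

  ⊑-trans : ∀ {h h′ H} → h ⊑ h′ → h′ ⊑ H → h ⊑ H
  ⊑-trans p refl     = p
  ⊑-trans p (grow r) = grow (⊑-trans p r)

  ∈-⊑ : ∀ {h H v} → h ⊑ H → v ∈ h → v ∈ H
  ∈-⊑ refl     v∈h = v∈h
  ∈-⊑ (grow p) v∈h = there (∈-⊑ p v∈h)

  follows-⊑ : ∀ {X h H} → h ⊑ H → Follows X H → Follows X h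
  follows-⊑ refl     f       = f
  follows-⊑ (grow p) (_ ∷ f) = follows-⊑ p f

  value : ∀ {h v} → v ∈ h →
          Σ[ a ∈ (Slot → Bool) ] (∀ X → Follows X h → ∀ l s → X (v , l , s) ≡ a l)
  value {v ∷ h} (here refl) = reply h v , λ { X (eq ∷ _) → eq }
  value (there v∈h) = map₂ (λ holds → λ { X (_ ∷ f) → holds X f }) (value v∈h)

  unique-∷ : ∀ {v : Site} {h} → v ∉ h → Unique h → Unique (v ∷ h)
  unique-∷ v∉h uniq = All.tabulate (λ { u∈h refl → v∉h u∈h }) ∷ uniq

  reveal : ∀ v h → Unique h → ∃[ h′ ] h ⊑ h′ × Unique h′ × length h′ ≤ suc (length h) × v ∈ h′
  reveal v h uniq with v ∈? h
  ... | yes v∈h = h , refl , uniq , ℕ.n≤1+n _ , v∈h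
  ... | no v∉h  = v ∷ h , grow refl , unique-∷ v∉h uniq , ℕ.≤-refl , here refl

  view-element : ∀ x i → view x (element {Position} i) ≡ lookup x i
  view-element x i = cong (lookup x) (number∘element {Position} i)

  Played : DecisionTree arity → List Site → Set
  Played t h = ∃[ h′ ] h ⊑ h′ × Unique h′ × length h′ ≤ length h + depth t ×
    (∀ x y → Follows (view x) h′ → Follows (view y) h′ → eval t x ≡ eval t y)

  -- The replies fix a single path through the tree, on which each query adds at most one site. All
  -- inputs following the final history reach the same leaf.
  play : ∀ t h → Unique h → Played t h
  play (leaf _) h uniq = h , refl , uniq , ℕ.m≤m+n _ 0 , λ _ _ _ _ → refl
  play (query i t₀ t₁) h uniq =
    let v , l , s = element {Position} i
        h₁ , h⊑h₁ , uniq₁ , len₁ , v∈h₁ = reveal v h uniq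
        a , holds = value v∈h₁
        h₂ , h₁⊑h₂ , uniq₂ , len₂ , same = play-branch (a l) h₁ uniq₁
        answer : ∀ x → Follows (view x) h₂ → lookup x i ≡ a l
        answer x f = trans (sym (view-element x i)) (holds (view x) (follows-⊑ h₁⊑h₂ f) l s)
    in h₂ , ⊑-trans h⊑h₁ h₁⊑h₂ , uniq₂ ,
       (let open ℕ.≤-Reasoning in begin
         length h₂                              ≤⟨ len₂ ⟩
         length h₁ + depth (branch (a l))       ≤⟨ ℕ.+-mono-≤ len₁ (depth-branch (a l)) ⟩
         suc (length h) + (depth t₀ ⊔ depth t₁) ≡⟨ ℕ.+-suc (length h) _ ⟨
         length h + suc (depth t₀ ⊔ depth t₁)   ∎) ,
       λ x y fx fy → trans (eval-query x (answer x fx))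
         (trans (same x y fx fy) (sym (eval-query y (answer y fy))))
    where
    branch : Bool → DecisionTree arity
    branch b = if b then t₁ else t₀

    play-branch : ∀ b h → Unique h → Played (branch b) h
    play-branch true  = play t₁
    play-branch false = play t₀

    depth-branch : ∀ b → depth (branch b) ≤ depth t₀ ⊔ depth t₁
    depth-branch true  = ℕ.m≤n⊔m (depth t₀) (depth t₁)
    depth-branch false = ℕ.m≤m⊔n (depth t₀) (depth t₁)

    eval-query : ∀ x {b} → lookup x i ≡ b → eval (query i t₀ t₁) x ≡ eval (branch b) x
    eval-query x {b} eq with lookup x i | eq
    ... | true  | refl = refl
    ... | false | refl = refl

  -- Sites the tree has not probed are probed artificially, keeping `w` open, to reach a history
  -- that misses only one site.
  fill : ∀ (vs : List Site) w h → Unique h → w ∉ h →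
         ∃[ H ] h ⊑ H × Unique H × w ∉ H × (∀ v → v ∈ vs → v ≢ w → v ∈ H)
  fill [] w h uniq w∉h = h , refl , uniq , w∉h , λ _ ()
  fill (v ∷ vs) w h uniq w∉h with v ≟ w | v ∈? h
  ... | yes refl | _ =
    let H , h⊑H , uniqH , w∉H , full = fill vs w h uniq w∉h
    in H , h⊑H , uniqH , w∉H , λ where
      _ (here refl) ne → contradiction refl ne
      v (there v∈)  ne → full v v∈ ne
  ... | no _ | yes v∈h =
    let H , h⊑H , uniqH , w∉H , full = fill vs w h uniq w∉h
    in H , h⊑H , uniqH , w∉H , λ where
      _ (here refl) ne → ∈-⊑ h⊑H v∈h
      v (there v∈)  ne → full v v∈ ne
  ... | no v≢w | no v∉h =
    let H , h⊑H , uniqH , w∉H , full = fill vs w (v ∷ h) (unique-∷ v∉h uniq)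
          λ { (here refl) → v≢w refl ; (there w∈h) → w∉h w∈h }
    in H , ⊑-trans (grow refl) h⊑H , uniqH , w∉H , λ where
      _ (here refl) ne → ∈-⊑ h⊑H (here refl)
      v (there v∈)  ne → full v v∈ ne

  input : List Site → (Slot → Bool) → Input
  input []      w (_ , l , _) = w l
  input (v ∷ h) w (v′ , l , s) = if does (v′ ≟ v) then reply h v l else input h w (v′ , l , s)

  input-outside : ∀ {h w v} → v ∉ h → ∀ l s → input h w (v , l , s) ≡ w l
  input-outside {[]} v∉h l s = refl
  input-outside {v′ ∷ h} {w} {v} v∉h l s rewrite dec-false (v ≟ v′) (v∉h ∘ here) =
    input-outside (v∉h ∘ there) l s

  follows-cong : ∀ {X Y h} → (∀ {v} → v ∈ h → Agree X Y v) → Follows X h → Follows Y h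
  follows-cong agree []       = []
  follows-cong agree (eq ∷ f) =
    (λ l s → trans (sym (agree (here refl) l s)) (eq l s)) ∷ follows-cong (agree ∘ there) f

  input-follows : ∀ {h} w → Unique h → Follows (input h w) h
  input-follows {[]}    w _           = []
  input-follows {v ∷ h} w (v∉ ∷ uniq) =
    (λ l s → cong (λ b → if b then reply h v l else input h w (v , l , s)) (dec-true (v ≟ v) refl))
    ∷ follows-cong (λ {u} u∈h l s → cong (λ b → if b then reply h v l else input h w (u , l , s))
                       (sym (dec-false (u ≟ v) λ { refl → All.lookup v∉ u∈h refl })))
                   (input-follows w uniq)

  realise : Input → Vec Bool arity
  realise X = tabulate (X ∘ element {Position})

  view-realise : ∀ X p → view (realise X) p ≡ X p
  view-realise X p = trans (lookup∘tabulate _ (number {Position} p)) (cong X (element∘number {Position} p))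

  sites : List Site
  sites = List.map element (allFin (order {Site}))

  ∈-sites : ∀ v → v ∈ sites
  ∈-sites v = subst (_∈ sites) (element∘number v) (∈-map⁺ element (∈-allFin (number v)))

  -- After filling up the history, the site `w` is answered once as a head pointing to the chain and
  -- once as a blank.
  undetermined : ∀ {h} {w : Site} → Unique h → w ∉ h →
    ∃[ x ] ∃[ y ] Follows (view x) h × Follows (view y) h × Accepts (view x) × ¬ Accepts (view y)
  undetermined {h} {w@(β , c , ρ)} uniq w∉h
    with fill sites w h uniq w∉h
  ... | H , h⊑H , uniqH , w∉H , full =
    realise (input H pointing) , realise (input H blank) ,
    follows-⊑ h⊑H (plays pointing) , follows-⊑ h⊑H (plays blank) ,
    (β , ε , c , ρ , certificate uniqH (plays pointing) w∉H full′ (outside pointing)) ,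
    rejects uniqH (plays blank) w∉H full′ (outside blank)
    where
    pointing : Slot → Bool
    pointing = encode true ((c , ρ) ⊕ latest (chain H β) (c , ρ))

    full′ : ∀ v → v ≢ w → v ∈ H
    full′ v = full v (∈-sites v)

    plays : ∀ a → Follows (view (realise (input H a))) H
    plays a = follows-cong (λ _ l s → sym (view-realise (input H a) _)) (input-follows a uniqH)

    outside : ∀ a l s → view (realise (input H a)) (w , l , s) ≡ a l
    outside a l s = trans (view-realise (input H a) _) (input-outside w∉H l s)

  -- If the final history misses a site, the tree gives the same output on an accepted and a
  -- rejected input. So the history contains all sites, and its length is at most the depth.
  depth-≥ : ∀ t → Computes t pointerFunction → order {Site} ≤ depth t
  depth-≥ t computes with play t [] []
  ... | h , _ , uniq , short , same with any? (λ v → ¬? (v ∈? h))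
  ...   | no complete = ℕ.≤-trans
          (order≤length h λ v → decidable-stable (v ∈? h) λ v∉h → complete (v , v∉h)) short
  ...   | yes (w , w∉h) with undetermined uniq w∉h
  ...     | x , y , fx , fy , acc , rej = contradiction
            (trans (sym (dec-true (accepts? _) acc))
              (trans (sym (computes x)) (trans (same x y fx fy)
                (trans (computes y) (dec-false (accepts? _) rej)))))
            λ ()

  D-≥ : order {Site} ≤ D pointerFunction
  D-≥ with leastDepth pointerFunction
  ... | _ , (t , computes , refl) , _ = depth-≥ t computes

  -- Growth of the parameters

  side≤sites : side ≤ order {Site}
  side≤sites = ℕ.m≤m*n side (side * side) {{ℕ.m*n≢0 side side {{side≢0}} {{side≢0}}}}
    where
    side≢0 : NonZero side
    side≢0 = ℕ.m^n≢0 2 (2 ^ q)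

  side≤arity : side ≤ arity
  side≤arity = ℕ.≤-trans side≤sites
    (ℕ.m≤m*n (order {Site}) (2 ^ (2 + q) * 4) {{ℕ.m*n≢0 (2 ^ (2 + q)) 4 {{ℕ.m^n≢0 2 (2 + q)}}}})

  -- The factor `2 ^ q` that the slots contribute to the sensitivity bound is the logarithm of
  -- `side`.
  log-arity : 2 ^ q ≤ ⌊log₂ arity ⌋
  log-arity = subst (_≤ ⌊log₂ arity ⌋) (⌊log₂[2^n]⌋≡n (2 ^ q)) (⌊log₂⌋-mono-≤ side≤arity)

  q≤side : q ≤ side
  q≤side = ℕ.≤-trans (n≤2^n q) (n≤2^n (2 ^ q))
    where
    n≤2^n : ∀ n → n ≤ 2 ^ n
    n≤2^n zero    = z≤n
    n≤2^n (suc n) = ℕ.+-mono-≤ (ℕ.m^n>0 2 n) (ℕ.≤-trans (n≤2^n n) (ℕ.m≤m+n (2 ^ n) 0))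

  -- The 32 is 2 for column and walk, times 4 families of slots, times 4 copies.
  s-≤-32*side*2^q : s pointerFunction ≤ 32 * (side * 2 ^ q)
  s-≤-32*side*2^q = subst (s pointerFunction ≤_) (collect side (2 ^ q)) s-≤
    where
    open +-*-Solver
    collect : ∀ m p → 2 * m * (2 * (2 * p) * 4) ≡ 32 * (m * p)
    collect = solve 2
      (λ m p → con 2 :* m :* (con 2 :* (con 2 :* p) :* con 4) := con 32 :* (m :* p)) refl

theorem1p2 : Σ[ N ∈ (ℕ → ℕ) ] Σ[ F ∈ ((i : ℕ) → BoolFun (N i)) ]
    (∀ i → Transitive (F i)) ×
    TendsToInfinity N ×
    TendsToInfinity (λ i → D (F i)) ×
    ((λ i → D (F i)) =Ω̃[ N ] (λ i → s (F i) ^ 3))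
theorem1p2 = arity , pointerFunction , pointerFunction-transitive ,
  (λ m → m , λ i m≤i → ℕ.≤-trans m≤i (ℕ.≤-trans (q≤side i) (side≤arity i))) ,
  (λ m → m , λ i m≤i → ℕ.≤-trans m≤i (ℕ.≤-trans (q≤side i) (ℕ.≤-trans (side≤sites i) (D-≥ i)))) ,
  Ω̃-cube (λ i → D (pointerFunction i)) arity (λ i → s (pointerFunction i)) 32
    side (2 ^_) s-≤-32*side*2^q D-≥ log-arity
  where open PointerFunction
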